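{- Let $G$ be a fuzzy automaton over the event set $E$, with generated fuzzy language $\mathcal{L}(G)$, and let $\mathcal{K}\subseteq\mathcal{L}(G)$ be a nonempty fuzzy language over $E$. Then there exists a partially observable fuzzy supervisor $S_P$ for $G$ such that $\mathcal{L}^{S_P}=\mathcal{K}$ if and only if $\mathcal{K}$ is controllable (with respect to $\mathcal{L}(G)$ and $E_{uc}$) and observable (with respect to $\mathcal{L}(G)$, $P$, and $E_c$).
   Context: $E$ is a finite set of events and $E^*$ is the set of all finite strings over $E$, including the empty string $\epsilon$. On $[0,1]$, $\wedge$ denotes infimum (minimum) and $\vee$ supremum (the supremum of the empty set is $0$). A fuzzy subset of a set $X$ is a function $X\to[0,1]$; $\mathcal{F}(X)$ is the set of all of them; $\mathcal{A}\subseteq\mathcal{B}$ means $\mathcal{A}(x)\le\mathcal{B}(x)$ for all $x$; $\mathrm{supp}(\mathcal{A})=\{x:\mathcal{A}(x)>0\}$. A fuzzy language over $E$ is an $\mathcal{A}\in\mathcal{F}(E^*)$ which is either the empty fuzzy language $\mathcal{O}$ (identically $0$), or satisfies $\mathcal{A}(\epsilon)=1$ and $\mathcal{A}(\mu)\ge\mathcal{A}(\mu\nu)$ for all $\mu,\nu\in E^*$. "Nonempty" means different from $\mathcal{O}$. A fuzzy automaton is $G=(Q,E,\delta,q_0)$ with $Q$ a (finite or infinite) set of states, $q_0\in Q$ the initial state, and $\delta:Q\times E\times Q\to[0,1]$. Extend $\delta$ to $Q\times E^*\times Q$ by $\delta(p,\epsilon,q)=1$ if $q=p$ and $0$ otherwise,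 and $\delta(p,\omega a,q)=\vee_{r\in Q}(\delta(p,\omega,r)\wedge\delta(r,a,q))$. The generated fuzzy language is $\mathcal{L}(G)(\omega)=\vee_{q\in Q}\delta(q_0,\omega,q)$; it is a fuzzy language over $E$, that is, $\mathcal{L}(G)(\epsilon)=1$ and $\mathcal{L}(G)(\mu)\ge\mathcal{L}(G)(\mu\nu)$ for all $\mu,\nu\in E^*$. The event set is partitioned into controllable and uncontrollable events, $E=E_c\,\dot\cup\,E_{uc}$, and, independently, into observable and unobservable events, $E=E_o\,\dot\cup\,E_{uo}$. The natural projection $P:E^*\to E_o^*$ erases unobservable events: $P(\epsilon)=\epsilon$, $P(sa)=P(s)P(a)$, where $P(a)=a$ if $a\in E_o$ and $P(a)=\epsilon$ if $a\in E_{uo}$. A partially observable fuzzy supervisor for $G$ is a map $S_P:P[\mathrm{supp}(\mathcal{L}(G))]\to\mathcal{F}(E)$ with $S_P(t)(a)=1$ for all $t\in P[\mathrm{supp}(\mathcal{L}(G))]$ and $a\in E_{uc}$. The fuzzy language $\mathcal{L}^{S_P}$ generated by the controlled system is defined inductively by $\mathcal{L}^{S_P}(\epsilon)=1$ and $\mathcal{L}^{S_P}(sa)=\mathcal{L}(G)(sa)\wedge S_P[P(s)](a)\wedge\mathcal{L}^{S_P}(s)$ for $s\in E^*$, $a\in E$ (where the right side is taken to be $0$ when $s\notin\mathrm{supp}(\mathcal{L}(G))$, since then $\mathcal{L}(G)(sa)=0$). A fuzzy language $\mathcal{K}\subseteq\mathcal{L}$ is controllable with respect to $\mathcal{L}$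 and $E_{uc}$ if $\mathcal{K}(sa)=\mathcal{K}(s)\wedge\mathcal{L}(sa)$ for all $s\in E^*$ and $a\in E_{uc}$. It is observable with respect to $\mathcal{L}$, $P$, and $E_c$ if for all $s,s'\in\mathrm{supp}(\mathcal{K})$ with $P(s)=P(s')$ and all $a\in E_c$ with $sa\in\mathrm{supp}(\mathcal{K})$, there is some $x\in[0,1]$ with $\mathcal{K}(sa)=\mathcal{K}(s)\wedge\mathcal{L}(sa)\wedge x$ such that $\mathcal{K}(s'a)=\mathcal{K}(s')\wedge\mathcal{L}(s'a)\wedge x$. -}

module Defs where

open import Level using (0ℓ)
open import Data.Empty using (⊥-elim)
open import Data.List using (List; []; _∷_; _∷ʳ_; _++_; filter)
open import Data.List.Properties using (∷ʳ-injective)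
open import Data.List.Reverse using (Reverse; []; _∶_∶ʳ_; reverseView)
open import Data.Product using (∃; _×_; _,_; proj₁; proj₂)
open import Data.Rational as ℚ using (ℚ; 0ℚ; 1ℚ)
import Data.Rational.Properties as ℚₚ
open import Data.Sum using (_⊎_; inj₁; inj₂)
open import Function.Base using (id)
open import Relation.Nullary using (¬_)
open import Relation.Unary using (Pred; Decidable; _∈_; ∁)
open import Relation.Binary.PropositionalEquality using (_≡_; refl; cong)

-- The real interval [0,1].  A point x is given by its Dedekind (lower) cut,
-- the set of rationals q < x.  Having one-sided cuts makes arbitrary suprema
-- available without excluded middle; constructively these are the lower
-- reals.  Equality of reals is _≃_, not _≡_.

record 𝕀 : Set₁ where
  field
    below   : Pred ℚ 0ℓ
    lower   : ∀ {p q} → p ℚ.≤ q → below q → below p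
    rounded : ∀ {q} → below q → ∃ λ r → q ℚ.< r × below r
    0≤      : ∀ {q} → q ℚ.< 0ℚ → below q
    ≤1      : ∀ {q} → below q → q ℚ.< 1ℚ

open 𝕀 public

infix 4 _≤_ _≃_ _<_
infixr 6 _⊓_

_≤_ : 𝕀 → 𝕀 → Set
x ≤ y = ∀ {q} → below x q → below y q

_≃_ : 𝕀 → 𝕀 → Set
x ≃ y = x ≤ y × y ≤ x

_<_ : 𝕀 → 𝕀 → Set
x < y = ∃ λ q → ¬ below x q × below y q

0<1 : 0ℚ ℚ.< 1ℚ
0<1 = ℚₚ.positive⁻¹ 1ℚ

0𝕀 : 𝕀
0𝕀 = record
  { below   = ℚ._< 0ℚ
  ; lower   = ℚₚ.≤-<-trans
  ; rounded = ℚₚ.<-dense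
  ; 0≤      = id
  ; ≤1      = λ q<0 → ℚₚ.<-trans q<0 0<1
  }

1𝕀 : 𝕀
1𝕀 = record
  { below   = ℚ._< 1ℚ
  ; lower   = ℚₚ.≤-<-trans
  ; rounded = ℚₚ.<-dense
  ; 0≤      = λ q<0 → ℚₚ.<-trans q<0 0<1
  ; ≤1      = id
  }

_⊓_ : 𝕀 → 𝕀 → 𝕀
x ⊓ y = record
  { below   = λ q → below x q × below y q
  ; lower   = λ p≤q (u , v) → lower x p≤q u , lower y p≤q v
  ; rounded = λ (u , v) → meet (rounded x u) (rounded y v)
  ; 0≤      = λ q<0 → 0≤ x q<0 , 0≤ y q<0
  ; ≤1      = λ (u , _) → ≤1 x u
  }
  where
  meet : ∀ {q} → (∃ λ r → q ℚ.< r × below x r) → (∃ λ r → q ℚ.< r × below y r) →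
         ∃ λ r → q ℚ.< r × below x r × below y r
  meet (r , q<r , u) (s , q<s , v) with ℚₚ.≤-total r s
  ... | inj₁ r≤s = r , q<r , u , lower y r≤s v
  ... | inj₂ s≤r = s , q<s , lower x s≤r u , v

-- The summand q < 0 matters only for an empty index set, where ⋁ is 0.

⋁ : {I : Set} → (I → 𝕀) → 𝕀
⋁ {I} f = record
  { below   = λ q → q ℚ.< 0ℚ ⊎ ∃ λ i → below (f i) q
  ; lower   = low
  ; rounded = round
  ; 0≤      = inj₁
  ; ≤1      = λ { (inj₁ q<0) → ≤1 0𝕀 q<0 ; (inj₂ (i , u)) → ≤1 (f i) u }
  }
  where
  low : ∀ {p q} → p ℚ.≤ q → q ℚ.< 0ℚ ⊎ (∃ λ i → below (f i) q) →
        p ℚ.< 0ℚ ⊎ (∃ λ i → below (f i) p)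
  low p≤q (inj₁ q<0)     = inj₁ (ℚₚ.≤-<-trans p≤q q<0)
  low p≤q (inj₂ (i , u)) = inj₂ (i , lower (f i) p≤q u)

  round : ∀ {q} → q ℚ.< 0ℚ ⊎ (∃ λ i → below (f i) q) →
          ∃ λ r → q ℚ.< r × (r ℚ.< 0ℚ ⊎ ∃ λ i → below (f i) r)
  round (inj₁ q<0) with ℚₚ.<-dense q<0
  ... | r , q<r , r<0 = r , q<r , inj₁ r<0
  round (inj₂ (i , u)) with rounded (f i) u
  ... | r , q<r , v = r , q<r , inj₂ (i , v)

⊓-glb : ∀ {x y z} → z ≤ x → z ≤ y → z ≤ x ⊓ y
⊓-glb z≤x z≤y u = z≤x u , z≤y u

⋁-ub : ∀ {I : Set} (f : I → 𝕀) i → f i ≤ ⋁ f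
⋁-ub f i u = inj₂ (i , u)

⋁-lub : ∀ {I : Set} (f : I → 𝕀) z → (∀ i → f i ≤ z) → ⋁ f ≤ z
⋁-lub f z f≤z (inj₁ q<0)     = 0≤ z q<0
⋁-lub f z f≤z (inj₂ (i , u)) = f≤z i u

-- "x if A holds and 0 otherwise", for a possibly undecidable A.

infixr 5 _⊙_

_⊙_ : (A : Set) → (A → 𝕀) → 𝕀
A ⊙ x = ⋁ {A} x

⊙-true : ∀ {A : Set} (x : 𝕀) → A → (A ⊙ λ _ → x) ≃ x
⊙-true x a = ⋁-lub (λ _ → x) x (λ _ u → u) , ⋁-ub (λ _ → x) a

⊙-false : ∀ {A : Set} (x : A → 𝕀) → ¬ A → (A ⊙ x) ≃ 0𝕀
⊙-false x ¬a = ⋁-lub x 0𝕀 (λ a → ⊥-elim (¬a a)) , 0≤ (⋁ x)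

FuzzySubset : Set → Set₁
FuzzySubset X = X → 𝕀

infix 4 _⊑_ _≐_

_⊑_ : {X : Set} → FuzzySubset X → FuzzySubset X → Set
A ⊑ B = ∀ x → A x ≤ B x

_≐_ : {X : Set} → FuzzySubset X → FuzzySubset X → Set
A ≐ B = ∀ x → A x ≃ B x

supp : {X : Set} → FuzzySubset X → Pred X 0ℓ
supp A x = 0𝕀 < A x

𝓞 : {X : Set} → FuzzySubset X
𝓞 _ = 0𝕀

Nonempty : {X : Set} → FuzzySubset X → Set
Nonempty A = ¬ (A ≐ 𝓞)

IsFuzzyLanguage : {E : Set} → FuzzySubset (List E) → Set
IsFuzzyLanguage A = A ≐ 𝓞 ⊎ (A [] ≃ 1𝕀 × ∀ μ ν → A (μ ++ ν) ≤ A μ)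

record FuzzyAutomaton (E : Set) : Set₁ where
  field
    Q  : Set
    δ  : Q → E → Q → 𝕀
    q₀ : Q

  -- Strings are extended at the right end, so the recursion runs along the
  -- reverse view of the string.

  δʳ : Q → ∀ {ω} → Reverse ω → Q → 𝕀
  δʳ p []            q = (q ≡ p) ⊙ λ _ → 1𝕀
  δʳ p (_ ∶ rs ∶ʳ a) q = ⋁ λ r → δʳ p rs r ⊓ δ r a q

  δ* : Q → List E → Q → 𝕀
  δ* p ω q = δʳ p (reverseView ω) q

  𝓛 : FuzzySubset (List E)
  𝓛 ω = ⋁ λ q → δ* q₀ ω q

open FuzzyAutomaton public using (𝓛)

-- E_o* is regarded as a subset of E*.

P : {E : Set} {Eo : Pred E 0ℓ} → Decidable Eo → List E → List E
P Eo? = filter Eo?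

P[supp_] : {E : Set} {Eo : Pred E 0ℓ} → FuzzySubset (List E) → Decidable Eo →
           Pred (List E) 0ℓ
P[supp L ] Eo? t = ∃ λ s → s ∈ supp L × P Eo? s ≡ t

record Supervisor {E : Set} (G : FuzzyAutomaton E) (Euc : Pred E 0ℓ)
                  {Eo : Pred E 0ℓ} (Eo? : Decidable Eo) : Set₁ where
  field
    S              : ∀ t → t ∈ P[supp 𝓛 G ] Eo? → FuzzySubset E
    -- The value depends on t alone, not on a string s projecting to t.
    S-irrelevant   : ∀ t (m m′ : t ∈ P[supp 𝓛 G ] Eo?) → S t m ≐ S t m′
    uncontrollable : ∀ t m a → a ∈ Euc → S t m a ≃ 1𝕀

  𝓛ʳ : ∀ {s} → Reverse s → 𝕀
  𝓛ʳ []            = 1𝕀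
  𝓛ʳ (s ∶ rs ∶ʳ a) = (s ∈ supp (𝓛 G)) ⊙ λ m →
    𝓛 G (s ∷ʳ a) ⊓ S (P Eo? s) (s , m , refl) a ⊓ 𝓛ʳ rs

  𝓛ˢ : FuzzySubset (List E)
  𝓛ˢ s = 𝓛ʳ (reverseView s)

open Supervisor public using (𝓛ˢ)

Controllable : {E : Set} → FuzzySubset (List E) → FuzzySubset (List E) →
               Pred E 0ℓ → Set
Controllable K L Euc = ∀ s a → a ∈ Euc → K (s ∷ʳ a) ≃ K s ⊓ L (s ∷ʳ a)

Observable : {E : Set} → FuzzySubset (List E) → FuzzySubset (List E) →
             {Eo : Pred E 0ℓ} → Decidable Eo → Pred E 0ℓ → Set₁
Observable K L Eo? Ec =
  ∀ s s′ → s ∈ supp K → s′ ∈ supp K → P Eo? s ≡ P Eo? s′ →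
  ∀ a → a ∈ Ec → s ∷ʳ a ∈ supp K →
  ∃ λ x → K (s ∷ʳ a) ≃ K s ⊓ L (s ∷ʳ a) ⊓ x ×
          K (s′ ∷ʳ a) ≃ K s′ ⊓ L (s′ ∷ʳ a) ⊓ x

Reverse-unique : ∀ {E : Set} {xs ys : List E} (eq : xs ≡ ys)
                 (r : Reverse xs) (r′ : Reverse ys) →
                 _≡_ {A = ∃ Reverse} (xs , r) (ys , r′)
Reverse-unique eq [] [] = refl
Reverse-unique eq [] ([] ∶ _ ∶ʳ _) with () ← eq
Reverse-unique eq [] ((_ ∷ _) ∶ _ ∶ʳ _) with () ← eq
Reverse-unique eq ([] ∶ _ ∶ʳ _) [] with () ← eq
Reverse-unique eq ((_ ∷ _) ∶ _ ∶ʳ _) [] with () ← eq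
Reverse-unique eq (xs ∶ r ∶ʳ x) (ys ∶ r′ ∶ʳ y) with ∷ʳ-injective xs ys eq
... | refl , refl with Reverse-unique refl r r′
... | refl = refl

reverseView-∷ʳ : ∀ {E : Set} (s : List E) a →
                 reverseView (s ∷ʳ a) ≡ s ∶ reverseView s ∶ʳ a
reverseView-∷ʳ s a =
  second (Reverse-unique refl (reverseView (s ∷ʳ a)) (s ∶ reverseView s ∶ʳ a))
  where
  second : ∀ {xs} {r r′ : Reverse xs} → _≡_ {A = ∃ Reverse} (xs , r) (xs , r′) → r ≡ r′
  second refl = refl

module _ {E : Set} (G : FuzzyAutomaton E) where
  open FuzzyAutomaton G using (δ; δ*; δʳ)

  δ*-[] : ∀ p q → δ* p [] q ≡ ((q ≡ p) ⊙ λ _ → 1𝕀)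
  δ*-[] p q = refl

  δ*-∷ʳ : ∀ p ω a q → δ* p (ω ∷ʳ a) q ≡ ⋁ λ r → δ* p ω r ⊓ δ r a q
  δ*-∷ʳ p ω a q = cong (λ rs → δʳ p rs q) (reverseView-∷ʳ ω a)

module _ {E : Set} {G : FuzzyAutomaton E} {Euc Eo : Pred E 0ℓ} {Eo? : Decidable Eo}
         (V : Supervisor G Euc Eo?) where
  open Supervisor V using (S; 𝓛ʳ)

  𝓛ˢ-[] : 𝓛ˢ V [] ≡ 1𝕀
  𝓛ˢ-[] = refl

  𝓛ˢ-∷ʳ : ∀ s a → 𝓛ˢ V (s ∷ʳ a) ≡ ((s ∈ supp (𝓛 G)) ⊙ λ m →
            𝓛 G (s ∷ʳ a) ⊓ S (P Eo? s) (s , m , refl) a ⊓ 𝓛ˢ V s)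
  𝓛ˢ-∷ʳ s a = cong 𝓛ʳ (reverseView-∷ʳ s a)

{-# OPTIONS --safe #-}
module Submission where

-- For the converse direction the supervisor enables a controllable event a
-- after observing t to the degree ⋁ { K (sa) : P s = t }.  If a degree q ≥ 0 lies
-- below that supremum, it lies below K (sa) for some s, so s and sa are in the
-- support of K, and observability carries q over from sa to every s′a with
-- P s′ = t.  Degrees q < 0 lie below everything, which is why deciding q < 0
-- replaces the classical case distinction on the support.

open import Defs
open import Level using (0ℓ)
open import Data.Empty using (⊥-elim)
open import Data.Fin using (Fin)
open import Data.List using (List; []; _∷_; _∷ʳ_)
open import Data.List.Reverse using (Reverse; []; _∶_∶ʳ_; reverseView)
open import Data.Product using (∃; _×_; _,_; proj₁; proj₂)
open import Data.Rational as ℚ using (0ℚ)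
import Data.Rational.Properties as ℚₚ
open import Data.Sum using (_⊎_; inj₁; inj₂; [_,_]′)
open import Function.Base using (const; id)
open import Function.Bundles using (_↔_; _⇔_; mk⇔)
open import Relation.Nullary using (¬_; yes; no)
open import Relation.Unary using (Pred; Decidable; ∁; _∈_)
open import Relation.Binary.PropositionalEquality using (_≡_; refl; subst)

-- A nonnegative `q` below `x` is itself a witness of `0𝕀 < x`, so after this reduction membership
-- in a support comes with the degree being tracked.
≤-nonneg : ∀ {x y} → (∀ {q} → ¬ q ℚ.< 0ℚ → below x q → below y q) → x ≤ y
≤-nonneg {y = y} h {q} u with q ℚₚ.<? 0ℚ
... | yes q<0 = 0≤ y q<0
... | no  q≮0 = h q≮0 u

supp-mono : {X : Set} {A B : FuzzySubset X} {x y : X} →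
            A x ≤ B y → x ∈ supp A → y ∈ supp B
supp-mono Ax≤By (q , q≮0 , u) = q , q≮0 , Ax≤By u

module _ {E : Set} {Euc Eo : Pred E 0ℓ} {Eo? : Decidable Eo} {G : FuzzyAutomaton E}
         (V : Supervisor G Euc Eo?) where
  open Supervisor V using (S; S-irrelevant)

  S-cong : ∀ {t t′} → t ≡ t′ → ∀ m m′ → S t m ≐ S t′ m′
  S-cong refl = S-irrelevant _

  module _ {K : FuzzySubset (List E)} (V≐K : 𝓛ˢ V ≐ K) where

    -- The recursion for `𝓛ˢ` joins over all proofs of `s ∈ supp (𝓛 G)`. Since `S` gives equal
    -- values for all of them, one fixed `m` can replace the join. Controllability and observability
    -- are both read off from this equation.
    generated-step : ∀ s a (m : s ∈ supp (𝓛 G)) →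
      K (s ∷ʳ a) ≃ K s ⊓ 𝓛 G (s ∷ʳ a) ⊓ S (P Eo? s) (s , m , refl) a
    generated-step s a m = below-step , above-step
      where
      σ : 𝕀
      σ = S (P Eo? s) (s , m , refl) a

      controlled : 𝕀
      controlled = (s ∈ supp (𝓛 G)) ⊙ λ m′ →
        𝓛 G (s ∷ʳ a) ⊓ S (P Eo? s) (s , m′ , refl) a ⊓ 𝓛ˢ V s

      controlled≃K : controlled ≃ K (s ∷ʳ a)
      controlled≃K = subst (_≃ K (s ∷ʳ a)) (𝓛ˢ-∷ʳ V s a) (V≐K (s ∷ʳ a))

      below-step : K (s ∷ʳ a) ≤ K s ⊓ 𝓛 G (s ∷ʳ a) ⊓ σ
      below-step k with proj₂ controlled≃K k
      -- This is the default value 0 of the guard: no proof of `s ∈ supp (𝓛 G)` can be extracted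
      -- here.
      ... | inj₁ q<0 = 0≤ (K s ⊓ 𝓛 G (s ∷ʳ a) ⊓ σ) q<0
      ... | inj₂ (m′ , l , e , v) =
        proj₁ (V≐K s) v , l , proj₁ (S-irrelevant _ (s , m′ , refl) (s , m , refl) a) e

      above-step : K s ⊓ 𝓛 G (s ∷ʳ a) ⊓ σ ≤ K (s ∷ʳ a)
      above-step (k , l , e) = proj₁ controlled≃K (inj₂ (m , l , e , proj₂ (V≐K s) k))

    module _ (K⊑L : K ⊑ 𝓛 G) where

      supp-K⊆supp-L : ∀ s → s ∈ supp K → s ∈ supp (𝓛 G)
      supp-K⊆supp-L s = supp-mono {A = K} {𝓛 G} {s} {s} (K⊑L s)

      generated⇒controllable : (∀ s a → K (s ∷ʳ a) ≤ K s) → Controllable K (𝓛 G) Euc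
      generated⇒controllable K-prefix s a uc =
        (λ k → K-prefix s a k , K⊑L (s ∷ʳ a) k) ,
        ≤-nonneg {K s ⊓ 𝓛 G (s ∷ʳ a)} {K (s ∷ʳ a)} λ {q} q≮0 (k , l) →
          -- The degree `q` puts `s` in the support of `𝓛 G`, where `S` is defined and, `a` being
          -- uncontrollable, has value 1.
          let m = q , q≮0 , K⊑L s k in
          proj₂ (generated-step s a m)
            (k , l , proj₂ (Supervisor.uncontrollable V _ (s , m , refl) a uc)
                       (≤1 (K s) k))

      -- The supervisor's own value serves as `x`: it sees only the projection, so it acts alike
      -- after `s` and `s′`.
      generated⇒observable : (Ec : Pred E 0ℓ) → Observable K (𝓛 G) Eo? Ec
      generated⇒observable _ s s′ s∈K s′∈K Ps≡Ps′ a _ _ =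
        S (P Eo? s) (s , m , refl) a , generated-step s a m ,
        (λ k → let (k′ , l , e) = proj₁ step′ k in k′ , l , proj₂ σ≃σ′ e) ,
        (λ (k′ , l , e) → proj₂ step′ (k′ , l , proj₁ σ≃σ′ e))
        where
        m     = supp-K⊆supp-L s s∈K
        m′    = supp-K⊆supp-L s′ s′∈K
        step′ = generated-step s′ a m′
        σ≃σ′  = S-cong Ps≡Ps′ (s , m , refl) (s′ , m′ , refl) a

prefix-closed : {E : Set} {K : FuzzySubset (List E)} → IsFuzzyLanguage K → Nonempty K →
                K [] ≃ 1𝕀 × (∀ s a → K (s ∷ʳ a) ≤ K s)
prefix-closed (inj₁ K≐𝓞)          K≢𝓞 = ⊥-elim (K≢𝓞 K≐𝓞)
prefix-closed (inj₂ (K[]≃1 , K-++)) _  = K[]≃1 , λ s a → K-++ s (a ∷ [])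

module _ {E : Set} {Ec Eo : Pred E 0ℓ} (Eo? : Decidable Eo)
         (G : FuzzyAutomaton E) (K : FuzzySubset (List E)) where

  -- The first summand supplies an index of value 1 exactly when `a` is uncontrollable, so the join
  -- is 1 there without a decision on `Ec`.
  degree : ∀ t a → ¬ a ∈ Ec ⊎ ∃ (λ s → P Eo? s ≡ t) → 𝕀
  degree t a = [ const 1𝕀 , (λ (s , _) → K (s ∷ʳ a)) ]′

  supremal : Supervisor G (∁ Ec) Eo?
  supremal = record
    { S              = λ t _ a → ⋁ (degree t a)
    ; S-irrelevant   = λ _ _ _ _ → id , id
    ; uncontrollable = λ t _ a uc →
        ≤1 (⋁ (degree t a)) , ⋁-ub (degree t a) (inj₁ uc)
    }

  module _ (Ec? : Decidable Ec) (K[]≃1 : K [] ≃ 1𝕀)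
           (K-prefix : ∀ s a → K (s ∷ʳ a) ≤ K s) (K⊑L : K ⊑ 𝓛 G)
           (con : Controllable K (𝓛 G) (∁ Ec)) (obs : Observable K (𝓛 G) Eo? Ec) where

    supremal-sound : ∀ s a →
      K s ⊓ 𝓛 G (s ∷ʳ a) ⊓ ⋁ (degree (P Eo? s) a) ≤ K (s ∷ʳ a)
    supremal-sound s a =
      ≤-nonneg {K s ⊓ 𝓛 G (s ∷ʳ a) ⊓ ⋁ (degree (P Eo? s) a)} {K (s ∷ʳ a)} sound
      where
      sound : ∀ {q} → ¬ q ℚ.< 0ℚ →
              below (K s ⊓ 𝓛 G (s ∷ʳ a) ⊓ ⋁ (degree (P Eo? s) a)) q → below (K (s ∷ʳ a)) q
      sound q≮0 (k , l , inj₁ q<0) = ⊥-elim (q≮0 q<0)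
      sound q≮0 (k , l , inj₂ (inj₁ uc , _)) = proj₂ (con s a uc) (k , l)
      sound {q} q≮0 (k , l , inj₂ (inj₂ (r , Pr≡Ps) , kra)) with Ec? a
      -- An index of the second kind can also occur for uncontrollable `a`, about which
      -- observability says nothing.
      ... | no uc = proj₂ (con s a uc) (k , l)
      ... | yes c =
        -- Since `q` lies below `K (r ∷ʳ a)`, it lies below the `x` given by observability, and the
        -- same `x` governs `K (s ∷ʳ a)`.
        let (_ , Kra≃ , Ksa≃) = obs r s (q , q≮0 , K-prefix r a kra) (q , q≮0 , k) Pr≡Ps
                                    a c (q , q≮0 , kra)
            (_ , _ , e) = proj₁ Kra≃ kra
        in proj₂ Ksa≃ (k , l , e)

    supremal-generates : ∀ {s} (rs : Reverse s) → Supervisor.𝓛ʳ supremal rs ≃ K s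
    supremal-generates []            = proj₂ K[]≃1 , proj₁ K[]≃1
    supremal-generates (s ∶ rs ∶ʳ a) = upper , lower′
      where
      upper : Supervisor.𝓛ʳ supremal (s ∶ rs ∶ʳ a) ≤ K (s ∷ʳ a)
      upper (inj₁ q<0)             = 0≤ (K (s ∷ʳ a)) q<0
      upper (inj₂ (_ , l , e , v)) =
        supremal-sound s a (proj₁ (supremal-generates rs) v , l , e)

      lower′ : K (s ∷ʳ a) ≤ Supervisor.𝓛ʳ supremal (s ∶ rs ∶ʳ a)
      lower′ = ≤-nonneg {K (s ∷ʳ a)} {Supervisor.𝓛ʳ supremal (s ∶ rs ∶ʳ a)} λ {q} q≮0 k →
        let ks = K-prefix s a k in
        -- The string `s` is itself an index of the join at `P Eo? s`, so the supervisor's degree is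
        -- at least `K (s ∷ʳ a)`.
        inj₂ ((q , q≮0 , K⊑L s ks) , K⊑L (s ∷ʳ a) k , inj₂ (inj₂ (s , refl) , k) ,
              proj₂ (supremal-generates rs) ks)

theorem1 : (E : Set) → (∃ λ n → E ↔ Fin n) →
    (Ec Eo : Pred E 0ℓ) (Ec? : Decidable Ec) (Eo? : Decidable Eo) →
    (G : FuzzyAutomaton E) (K : FuzzySubset (List E)) →
    IsFuzzyLanguage K → Nonempty K → K ⊑ 𝓛 G →
    (∃ λ (V : Supervisor G (∁ Ec) Eo?) → 𝓛ˢ V ≐ K)
    ⇔ (Controllable K (𝓛 G) (∁ Ec) × Observable K (𝓛 G) Eo? Ec)
theorem1 E _ Ec Eo Ec? Eo? G K K-lang K≢𝓞 K⊑L = mk⇔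
  (λ (V , V≐K) → generated⇒controllable V {K} V≐K K⊑L K-prefix ,
                 generated⇒observable V {K} V≐K K⊑L Ec)
  (λ (con , obs) → supremal Eo? G K ,
     λ s → supremal-generates Eo? G K Ec? K[]≃1 K-prefix K⊑L con obs (reverseView s))
  where
  K[]≃1 : K [] ≃ 1𝕀
  K[]≃1 = proj₁ (prefix-closed {K = K} K-lang K≢𝓞)

  K-prefix : ∀ s a → K (s ∷ʳ a) ≤ K s
  K-prefix = proj₂ (prefix-closed {K = K} K-lang K≢𝓞)
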